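{- Let $U$ be a finite set and $\mathcal{O}\subseteq\mathcal{P}(U)$ an independent set of obligations. Let $X\subseteq U$ be nonempty and $\preceq_s$-closed. Then: (1) $X$ contains the best element (i.e. every best element of $U$). (2) $X\prec_{l,s}U\setminus X$. (3) $X$ is (ui). (4) $X\in\mathcal{D}(\mathcal{O})$. (5) $X$ is a neighbourhood, and an improving neighbourhood, of the set of best elements in $U$.
   Context: $U$ is a finite set, and $\mathcal{O}\subseteq\mathcal{P}(U)$ is a set of "obligations". For $\mathcal{O}'\subseteq\mathcal{O}$, $\delta:\mathcal{O}'\to\{0,1\}$ and $m\in U$, $m\models\delta$ iff for all $O\in\mathcal{O}'$: $m\in O\Leftrightarrow\delta(O)=1$. $\mathcal{O}$ is independent iff for every $\delta:\mathcal{O}\to\{0,1\}$ there is $m\in U$ with $m\models\delta$. For $x,y\in U$: - $\mathcal{O}(x):=\{O\in\mathcal{O}: x\in O\}$. - Quality (set variant; smaller means better): $x\preceq_s y$ iff $\mathcal{O}(y)\subseteq\mathcal{O}(x)$; $x\prec_s y$ iff $\mathcal{O}(y)\subsetneq\mathcal{O}(x)$. - Distance (set variant): $d_s(x,y):=\mathcal{O}(x)\,\triangle\,\mathcal{O}(y)$ (symmetric difference); distances are compared by inclusion. - $[x,z]_s:=\{y\in U: d_s(x,z)=d_s(x,y)\cup d_s(y,z)\}$. - A best element of $U$ is some $x\in U$ such that there is no $z\in U$ with $z\prec_s x$. - $X\subseteq U$ is $\preceq_s$-closed iff for all $x\in X$, $y\in U$: $y\preceq_s x$ implies $y\in X$.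 - An element $x'$ of a set $Y$ is closest to $x$ in $Y$ iff there is no $x''\in Y$ with $d_s(x,x'')\subsetneq d_s(x,x')$. Let $x\parallel Y$ be the set of elements of $Y$ closest to $x$. - $X\prec_{l,s}Y$ iff for all $x\in X$ and all $y\in x\parallel Y$ we have $x\prec_s y$, and for all $y\in Y$ and all $x\in y\parallel X$ we have $x\prec_s y$. - $X$ is (ui) (union of intersections) iff there is a family $(\mathcal{O}_i)_{i\in I}$ with $\mathcal{O}_i\subseteq\mathcal{O}$ and $X=\bigcup_{i\in I}\bigcap\mathcal{O}_i$, where $\bigcap\emptyset:=U$. - $X\in\mathcal{D}(\mathcal{O})$ iff for all $\mathcal{O}'\subseteq\mathcal{O}$, all $\delta:\mathcal{O}'\to\{0,1\}$ and all $m,m'\in U$ with $m,m'\models\delta$, $m\in X$, $m'\notin X$, there is $m''\in X$ with $m''\models\delta$ and $m''\prec_s m'$. - For $B\subseteq Y\subseteq U$: $Y$ is a neighbourhood of $B$ in $U$ iff for all $y\in Y$ and all $x\in B$ closest to $y$ in $B$, $[x,y]_s\subseteq Y$. $Y$ is an improving neighbourhood of $B$ in $U$ iff for all $y\in Y$ and all $x$ that are closest to $y$ in $\{x'\in B: x'\preceq_s y\}$, $[x,y]_s\subseteq Y$. (Both notions require $B\subseteq Y$.) -}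

module Defs where

open import Level using (0ℓ)
open import Data.Bool using (Bool; true)
open import Data.Nat using (ℕ)
open import Data.Fin using (Fin)
open import Data.Fin.Subset using (Subset) renaming (_∈_ to _∈ˢ_)
open import Data.Product using (Σ-syntax; ∃-syntax; _×_)
open import Function.Bundles using (_⇔_)
open import Relation.Nullary using (¬_)
open import Relation.Unary
  using (Pred; _∈_; _∉_; _⊆_; _⊂_; _≐_; _∪_; _∩_; _∖_; ⋃)
open import Relation.Binary.PropositionalEquality using (_≡_)

-- The finite set U is Fin n, and obligations are elements of Subset n.
-- A set of obligations is given by its characteristic function, so that
-- membership is a proposition and a function on the set cannot depend on
-- the membership proof.
Family : ℕ → Set
Family n = Subset n → Bool

infix 4 _∈ᶠ_ _⊆ᶠ_ _⊨_

_∈ᶠ_ : ∀ {n} → Subset n → Family n → Set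
O ∈ᶠ 𝒪 = 𝒪 O ≡ true

_⊆ᶠ_ : ∀ {n} → Family n → Family n → Set
𝒪′ ⊆ᶠ 𝒪 = ∀ O → O ∈ᶠ 𝒪′ → O ∈ᶠ 𝒪

Assignment : ∀ {n} → Family n → Set
Assignment {n} 𝒪′ = (O : Subset n) → O ∈ᶠ 𝒪′ → Bool

_⊨_ : ∀ {n} {𝒪′ : Family n} → Fin n → Assignment 𝒪′ → Set
_⊨_ {𝒪′ = 𝒪′} m δ = ∀ O (O∈𝒪′ : O ∈ᶠ 𝒪′) → (m ∈ˢ O) ⇔ (δ O O∈𝒪′ ≡ true)

Independent : ∀ {n} → Family n → Set
Independent 𝒪 = (δ : Assignment 𝒪) → ∃[ m ] m ⊨ δ

-- The intersection of the empty family is all of Fin n.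
⋂ᶠ : ∀ {n} → Family n → Pred (Fin n) 0ℓ
⋂ᶠ 𝒪′ m = ∀ O → O ∈ᶠ 𝒪′ → m ∈ˢ O

module Obligations {n : ℕ} (𝒪 : Family n) where

  infix 4 _≼_ _≺_ _≺ₗ_
  infix 5 _∥_

  𝒪⟨_⟩ : Fin n → Pred (Subset n) 0ℓ
  𝒪⟨ x ⟩ O = O ∈ᶠ 𝒪 × x ∈ˢ O

  -- Smaller is better.
  _≼_ : Fin n → Fin n → Set
  x ≼ y = 𝒪⟨ y ⟩ ⊆ 𝒪⟨ x ⟩

  _≺_ : Fin n → Fin n → Set
  x ≺ y = 𝒪⟨ y ⟩ ⊂ 𝒪⟨ x ⟩

  d : Fin n → Fin n → Pred (Subset n) 0ℓ
  d x y = (𝒪⟨ x ⟩ ∖ 𝒪⟨ y ⟩) ∪ (𝒪⟨ y ⟩ ∖ 𝒪⟨ x ⟩)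

  [_,_]ₛ : Fin n → Fin n → Pred (Fin n) 0ℓ
  [ x , z ]ₛ y = d x z ≐ d x y ∪ d y z

  Best : Pred (Fin n) 0ℓ
  Best x = ¬ (∃[ z ] z ≺ x)

  Closed : Pred (Fin n) 0ℓ → Set
  Closed X = ∀ x y → x ∈ X → y ≼ x → y ∈ X

  -- The elements of Y closest to x.
  _∥_ : Fin n → Pred (Fin n) 0ℓ → Pred (Fin n) 0ℓ
  (x ∥ Y) x′ = x′ ∈ Y × ¬ (∃[ x″ ] (x″ ∈ Y × d x x″ ⊂ d x x′))

  _≺ₗ_ : Pred (Fin n) 0ℓ → Pred (Fin n) 0ℓ → Set
  X ≺ₗ Y =
    (∀ x y → x ∈ X → y ∈ x ∥ Y → x ≺ y) ×
    (∀ y x → y ∈ Y → x ∈ y ∥ X → x ≺ y)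

  UnionOfIntersections : Pred (Fin n) 0ℓ → Set₁
  UnionOfIntersections X =
    Σ[ I ∈ Set ] Σ[ 𝒪ᵢ ∈ (I → Family n) ]
      (∀ i → 𝒪ᵢ i ⊆ᶠ 𝒪) × X ≐ ⋃ I (λ i → ⋂ᶠ (𝒪ᵢ i))

  𝒟 : Pred (Fin n) 0ℓ → Set
  𝒟 X =
    (𝒪′ : Family n) → 𝒪′ ⊆ᶠ 𝒪 → (δ : Assignment 𝒪′) →
    ∀ m m′ → m ⊨ δ → m′ ⊨ δ → m ∈ X → m′ ∉ X →
    ∃[ m″ ] (m″ ∈ X × m″ ⊨ δ × m″ ≺ m′)

  Neighbourhood : (B Y : Pred (Fin n) 0ℓ) → Set
  Neighbourhood B Y =
    B ⊆ Y × (∀ y x → y ∈ Y → x ∈ y ∥ B → [ x , y ]ₛ ⊆ Y)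

  ImprovingNeighbourhood : (B Y : Pred (Fin n) 0ℓ) → Set
  ImprovingNeighbourhood B Y =
    B ⊆ Y × (∀ y x → y ∈ Y → x ∈ y ∥ (B ∩ (_≼ y)) → [ x , y ]ₛ ⊆ Y)

{-# OPTIONS --safe #-}

-- Independence says that every subset of 𝒪 is 𝒪(m) for some m.  In particular
-- any two elements x, y have a meet and a join, realising 𝒪(x) ∩ 𝒪(y) and
-- 𝒪(x) ∪ 𝒪(y).  If an element of X and an element closest to it outside X were
-- incomparable, their meet would be a strictly closer element outside X; in the
-- other direction the join is a strictly closer element of X.  The join also
-- gives the better element that 𝒟 asks for.  A best element b satisfies all of
-- 𝒪, so [b,y]ₛ consists of elements at least as good as y.
-- Every case distinction is on the decidable m ∈ O, never on membership in X.
module Submission where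

open import Level using (0ℓ)
open import Data.Bool using (true)
open import Data.Bool.Properties using () renaming (_≟_ to _≟ᵇ_)
open import Data.Nat using (ℕ)
open import Data.Fin using (Fin)
open import Data.Fin.Subset using (Subset)
open import Data.Fin.Subset.Properties using (_∈?_)
open import Data.Product using (_×_; _,_; proj₁; proj₂; ∃-syntax; Σ-syntax)
open import Data.Sum using (inj₁; inj₂; [_,_]′)
open import Function.Base using (_∘_)
open import Function.Bundles using (_⇔_; mk⇔; module Equivalence)
open import Relation.Nullary using (¬_; Dec; yes; no; contradiction)
open import Relation.Nullary.Decidable
  using (isYes; decidable-stable; _⊎-dec_; _×-dec_)
open import Relation.Unary
  using (Pred; Satisfiable; Decidable; _∈_; _⊆_; _⊂_; _≐_; _∪_; _∩_; ∁)
open import Relation.Unary.Properties using (U?)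
open import Relation.Binary.PropositionalEquality using (_≡_; refl)
open import Defs

open Equivalence using (to; from)

isYes≡true⇔ : ∀ {A : Set} (a? : Dec A) → isYes a? ≡ true ⇔ A
isYes≡true⇔ (yes a) = mk⇔ (λ _ → a) (λ _ → refl)
isYes≡true⇔ (no ¬a) = mk⇔ (λ ()) (λ a → contradiction a ¬a)

module _ {n : ℕ} (𝒪 : Family n) where
  open Obligations 𝒪

  -- Membership in a `Subset` is decidable, so double negation can be removed obligation by
  -- obligation. This lets the negative statement that an element is closest yield `x ≼ y`.
  ≼-stable : ∀ x y → ¬ ¬ (x ≼ y) → x ≼ y
  ≼-stable x y ¬¬x≼y {O} O∈y =
    proj₁ O∈y , decidable-stable (x ∈? O) λ x∉O → ¬¬x≼y λ x≼y → x∉O (proj₂ (x≼y O∈y))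

  -- Passing from `y` to the meet leaves only 𝒪(x) ∖ 𝒪(y) in the distance from `x`; what is lost,
  -- 𝒪(y) ∖ 𝒪(x), cannot be empty when `x ≼ y` fails.
  meet-closer : ∀ x y w → 𝒪⟨ w ⟩ ≐ 𝒪⟨ x ⟩ ∩ 𝒪⟨ y ⟩ → ¬ (x ≼ y) → d x w ⊂ d x y
  meet-closer x y w (w⊆x∩y , x∩y⊆w) x⋠y =
    (λ { (inj₁ (O∈x , O∉w)) → inj₁ (O∈x , λ O∈y → O∉w (x∩y⊆w (O∈x , O∈y)))
       ; (inj₂ (O∈w , O∉x)) → contradiction (proj₁ (w⊆x∩y O∈w)) O∉x }) ,
    λ dxy⊆dxw → x⋠y λ {O} O∈y →
      proj₁ O∈y , decidable-stable (x ∈? O) λ x∉O →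
        [ x∉O ∘ proj₂ ∘ proj₁
        , (λ (O∈w , O∉x) → O∉x (proj₁ (w⊆x∩y O∈w)))
        ]′ (dxy⊆dxw (inj₂ (O∈y , x∉O ∘ proj₂)))

  -- Dually, seen from `y`, the join keeps 𝒪(x) ∖ 𝒪(y) and loses 𝒪(y) ∖ 𝒪(x).
  join-closer : ∀ x y w → 𝒪⟨ w ⟩ ≐ 𝒪⟨ x ⟩ ∪ 𝒪⟨ y ⟩ → ¬ (x ≼ y) → d y w ⊂ d y x
  join-closer x y w (w⊆x∪y , x∪y⊆w) x⋠y =
    (λ { (inj₁ (O∈y , O∉w)) → contradiction (x∪y⊆w (inj₂ O∈y)) O∉w
       ; (inj₂ (O∈w , O∉y)) →
           [ (λ O∈x → inj₂ (O∈x , O∉y)) , (λ O∈y → contradiction O∈y O∉y) ]′ (w⊆x∪y O∈w) }) ,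
    λ dyx⊆dyw → x⋠y λ {O} O∈y →
      proj₁ O∈y , decidable-stable (x ∈? O) λ x∉O →
        [ (λ (_ , O∉w) → O∉w (x∪y⊆w (inj₂ O∈y)))
        , (λ (_ , O∉y) → O∉y O∈y)
        ]′ (dyx⊆dyw (inj₁ (O∈y , x∉O ∘ proj₂)))

  -- The intersection of 𝒪(x) is the cone of all `y ≼ x`, and a closed set is the union of the cones
  -- of its elements.
  closed-ui : ∀ {X} → Closed X → UnionOfIntersections X
  closed-ui {X} closed =
    (Σ[ x ∈ Fin n ] X x) , (λ (x , _) O → isYes (∈𝒪? x O)) ,
    (λ (x , _) O O∈x → proj₁ (to (isYes≡true⇔ (∈𝒪? x O)) O∈x)) ,
    (λ {x} x∈X → (x , x∈X) , λ O O∈x → proj₂ (to (isYes≡true⇔ (∈𝒪? x O)) O∈x)) ,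
    (λ {y} ((x , x∈X) , y∈⋂) → closed x y x∈X λ {O} O∈x →
      proj₁ O∈x , y∈⋂ O (from (isYes≡true⇔ (∈𝒪? x O)) O∈x))
    where
    ∈𝒪? : ∀ x → Decidable 𝒪⟨ x ⟩
    ∈𝒪? x O = (𝒪 O ≟ᵇ true) ×-dec (x ∈? O)

  module _ (independent : Independent 𝒪) where

    realise : ∀ {P : Pred (Subset n) 0ℓ} → Decidable P → ∃[ m ] 𝒪⟨ m ⟩ ≐ (_∈ᶠ 𝒪) ∩ P
    realise P? with independent (λ O _ → isYes (P? O))
    ... | m , m⊨ =
      m ,
      (λ {O} (O∈𝒪 , m∈O) → O∈𝒪 , to (isYes≡true⇔ (P? O)) (to (m⊨ O O∈𝒪) m∈O)) ,
      (λ {O} (O∈𝒪 , PO) → O∈𝒪 , from (m⊨ O O∈𝒪) (from (isYes≡true⇔ (P? O)) PO))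

    meet : ∀ x y → ∃[ w ] 𝒪⟨ w ⟩ ≐ 𝒪⟨ x ⟩ ∩ 𝒪⟨ y ⟩
    meet x y with realise (λ O → (x ∈? O) ×-dec (y ∈? O))
    ... | w , w⊆ , ⊆w =
      w ,
      (λ O∈w → let O∈𝒪 , x∈O , y∈O = w⊆ O∈w in (O∈𝒪 , x∈O) , (O∈𝒪 , y∈O)) ,
      (λ ((O∈𝒪 , x∈O) , (_ , y∈O)) → ⊆w (O∈𝒪 , x∈O , y∈O))

    join : ∀ x y → ∃[ w ] 𝒪⟨ w ⟩ ≐ 𝒪⟨ x ⟩ ∪ 𝒪⟨ y ⟩
    join x y with realise (λ O → (x ∈? O) ⊎-dec (y ∈? O))
    ... | w , w⊆ , ⊆w =
      w ,
      (λ O∈w → let O∈𝒪 , x∨y = w⊆ O∈w in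
        [ (λ x∈O → inj₁ (O∈𝒪 , x∈O)) , (λ y∈O → inj₂ (O∈𝒪 , y∈O)) ]′ x∨y) ,
      [ (λ (O∈𝒪 , x∈O) → ⊆w (O∈𝒪 , inj₁ x∈O)) , (λ (O∈𝒪 , y∈O) → ⊆w (O∈𝒪 , inj₂ y∈O)) ]′

    -- Some `t` satisfies every obligation; if `b` missed one, `t` would be strictly better.
    best-satisfies-all : ∀ {b} → Best b → (_∈ᶠ 𝒪) ⊆ 𝒪⟨ b ⟩
    best-satisfies-all {b} best {O} O∈𝒪 with realise U?
    ... | t , _ , all⊆t =
      O∈𝒪 , decidable-stable (b ∈? O) λ b∉O →
        best (t , (λ O∈b → all⊆t (proj₁ O∈b , _)) ,
              λ t⊆b → b∉O (proj₂ (t⊆b (all⊆t (O∈𝒪 , _)))))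

    -- An obligation met by `y` is also met by `b`, so it is not in `d b y`; if `z` missed it, it
    -- would be in `d b z`.
    best-interval-≼ : ∀ b y z → Best b → z ∈ [ b , y ]ₛ → z ≼ y
    best-interval-≼ b y z best (_ , ⊆dby) {O} O∈y =
      proj₁ O∈y , decidable-stable (z ∈? O) λ z∉O →
        [ (λ (_ , O∉y) → O∉y O∈y) , (λ (_ , O∉b) → O∉b O∈b) ]′
          (⊆dby (inj₁ (inj₁ (O∈b , z∉O ∘ proj₂))))
      where O∈b = best-satisfies-all best (proj₁ O∈y)

    module _ {X : Pred (Fin n) 0ℓ} (closed : Closed X) where

      best⊆closed : Satisfiable X → Best ⊆ X
      best⊆closed (x , x∈X) {b} best =
        closed x b x∈X λ O∈x → best-satisfies-all best (proj₁ O∈x)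

      closed-≺ₗ-∁ : X ≺ₗ ∁ X
      closed-≺ₗ-∁ =
        (λ x y x∈X (y∉X , closest) →
          ≼-stable x y (λ x⋠y → let w , w≐ = meet x y in
            -- The meet is no better than `y`, so it lies outside `X` as `y` does.
            closest (w , (λ w∈X → y∉X (closed w y w∈X (proj₂ ∘ proj₁ w≐))) ,
                     meet-closer x y w w≐ x⋠y)) ,
          λ y≼x → y∉X (closed x y x∈X y≼x)) ,
        (λ y x y∉X (x∈X , closest) →
          ≼-stable x y (λ x⋠y → let w , w≐ = join x y in
            closest (w , closed x w x∈X (proj₂ w≐ ∘ inj₁) ,
                     join-closer x y w w≐ x⋠y)) ,
          λ y≼x → y∉X (closed x y x∈X y≼x))

      closed-𝒟 : 𝒟 X
      closed-𝒟 𝒪′ 𝒪′⊆𝒪 δ m m′ m⊨δ m′⊨δ m∈X m′∉X with join m m′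
      ... | w , w⊆ , ⊆w =
        w , w∈X ,
        (λ O O∈𝒪′ → mk⇔
          -- On 𝒪′ both `m` and `m′` follow `δ`, hence so does their join.
          (λ w∈O → [ to (m⊨δ O O∈𝒪′) ∘ proj₂ , to (m′⊨δ O O∈𝒪′) ∘ proj₂ ]′
                     (w⊆ (𝒪′⊆𝒪 O O∈𝒪′ , w∈O)))
          (λ δO → proj₂ (⊆w (inj₁ (𝒪′⊆𝒪 O O∈𝒪′ , from (m⊨δ O O∈𝒪′) δO))))) ,
        (⊆w ∘ inj₂) ,
        λ m′≼w → m′∉X (closed w m′ w∈X m′≼w)
        where
        w∈X : w ∈ X
        w∈X = closed m w m∈X (⊆w ∘ inj₁)

      best-interval⊆closed : ∀ b y → Best b → y ∈ X → [ b , y ]ₛ ⊆ X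
      best-interval⊆closed b y best y∈X {z} z∈[b,y] =
        closed y z y∈X (best-interval-≼ b y z best z∈[b,y])

fact4p3 : (n : ℕ) (𝒪 : Family n) → Independent 𝒪 →
    let open Obligations 𝒪 in
    (X : Pred (Fin n) 0ℓ) → Satisfiable X → Closed X →
    Best ⊆ X ×
    X ≺ₗ ∁ X ×
    UnionOfIntersections X ×
    𝒟 X ×
    (Neighbourhood Best X × ImprovingNeighbourhood Best X)
fact4p3 n 𝒪 independent X inhabited closed =
  best⊆X , closed-≺ₗ-∁ 𝒪 independent closed , closed-ui 𝒪 closed ,
  closed-𝒟 𝒪 independent closed ,
  (best⊆X , λ y b y∈X (best , _) → interval⊆X b y best y∈X) ,
  (best⊆X , λ y b y∈X ((best , _) , _) → interval⊆X b y best y∈X)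
  where
  open Obligations 𝒪
  best⊆X : Best ⊆ X
  best⊆X = best⊆closed 𝒪 independent closed inhabited
  interval⊆X : ∀ b y → Best b → y ∈ X → [ b , y ]ₛ ⊆ X
  interval⊆X = best-interval⊆closed 𝒪 independent closed
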